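{- Let $k\geq 1$ and let $u$ be the $\mathcal{P}(\mathbb{Z})/\mathcal{I}_{k\text{ - }\mathsf{thin}}$-generic ultrafilter on $\mathbb{Z}$ over the ground model $V$. Then (in the generic extension $V[u]$) $u$ is a P-point that is not $\mathbb{Z}$-Ramsey.
   Context: A set $A\subseteq\mathbb{Z}$ is $k$-thin if $|(g+A)\cap A|\leq k$ for every $g\in\mathbb{Z}\setminus\{0\}$. $\mathcal{I}_{k\text{ - }\mathsf{thin}}$ is the ideal on $\mathbb{Z}$ consisting of all $I\subseteq\mathbb{Z}$ that are contained in a union of finitely many $k$-thin sets. $\mathcal{P}(\mathbb{Z})/\mathcal{I}_{k\text{ - }\mathsf{thin}}$ is the quotient Boolean algebra, whose nonzero elements are used as a forcing notion (equivalently, one forces with the $\mathcal{I}_{k\text{ - }\mathsf{thin}}$-positive sets, i.e. the sets $X\subseteq\mathbb{Z}$ with $X\notin\mathcal{I}_{k\text{ - }\mathsf{thin}}$, ordered by $\subseteq$); the generic ultrafilter $u$ is the family of all $A\subseteq\mathbb{Z}$ whose equivalence class belongs to the generic filter. A nonprincipal ultrafilter on a countable set $S$ is a P-point if every function $f:S\to\omega$ is constant or finite-to-one on some element of it. A colouring $c:[\mathbb{Z}]^2\to 2$ is $\mathbb{Z}$-invariant if $c(\{x,y\})=c(\{x+z,y+z\})$ for all distinct $x,y\in\mathbb{Z}$ and all $z\in\mathbb{Z}$. An ultrafilter $u$ on $\mathbb{Z}$ is $\mathbb{Z}$-Ramsey if for every $\mathbb{Z}$-invariant colouring $c:[\mathbb{Z}]^2\to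 2$ there is $A\in u$ such that $c$ is constant on $[A]^2$. -}

module Defs where

open import Data.Fin using (Fin)
open import Data.Integer using (ℤ; 0ℤ; _+_; _<_)
open import Data.Integer.Properties using (+-monoʳ-<)
open import Data.List using (List; length)
open import Data.List.Membership.Propositional using () renaming (_∈_ to _∈ᴸ_)
open import Data.List.Relation.Unary.All using (All)
open import Data.List.Relation.Unary.Any using (Any)
open import Data.List.Relation.Unary.Unique.Propositional using (Unique)
open import Data.Nat using (ℕ) renaming (_≤_ to _≤ᴺ_)
open import Data.Product using (∃; ∃-syntax; _×_; _,_)
open import Data.Sum using (_⊎_)
open import Level using (Level; 0ℓ; suc; _⊔_; Lift)
open import Relation.Binary using (Rel)
open import Relation.Binary.PropositionalEquality using (_≡_; _≢_)
open import Relation.Nullary using (¬_)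
open import Relation.Unary using (Pred; _∈_; _∉_; _⊆_; _∩_; _∖_; ∅)

-- Increasing pairs represent the two-element subsets of ℤ.

record [ℤ]² : Set where
  constructor pair
  field
    lo hi  : ℤ
    .lo<hi : lo < hi

translate : ℤ → [ℤ]² → [ℤ]²
translate z (pair x y x<y) = pair (z + x) (z + y) (+-monoʳ-< z x<y)

-- The Cohen forcing relation.  The ground model V is the ambient theory; a
-- sentence φ of the forcing language is identified with the set of conditions
-- forcing it, so that φ p reads "p ⊩ φ", and smaller conditions are stronger.
-- By the forcing theorem, φ holds in V[G] for every V-generic filter G
-- exactly when every condition forces φ.

module Forcing {c : Level} {Cond : Set c} (_≤_ : Rel Cond c) where

  Sentence : (ℓ : Level) → Set (c ⊔ suc ℓ)
  Sentence ℓ = Pred Cond ℓ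

  DenseBelow : ∀ {ℓ} → Cond → Pred Cond ℓ → Set (c ⊔ ℓ)
  DenseBelow p D = ∀ q → q ≤ p → ∃[ r ] (r ≤ q × D r)

  ⊩_ : ∀ {ℓ} → Sentence ℓ → Set (c ⊔ ℓ)
  ⊩ φ = ∀ p → φ p

  infix  5 ⊩_
  infix  9 ∼_
  infixr 8 _∧_
  infixr 7 _∨_
  infixr 6 _⇒_
  infix  6 _⇔_
  infixr 6 ⋀ ⋁
  syntax ⋀ (λ x → φ) = ⋀[ x ] φ
  syntax ⋁ (λ x → φ) = ⋁[ x ] φ

  -- A statement about elements of V that is absolute between V and V[G].
  ⌜_⌝ : ∀ {ℓ} → Set ℓ → Sentence ℓ
  ⌜ P ⌝ _ = P

  _∧_ _∨_ _⇒_ _⇔_ : ∀ {ℓ m} → Sentence ℓ → Sentence m → Sentence _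
  (φ ∧ ψ) p = φ p × ψ p
  (φ ∨ ψ) p = DenseBelow p (λ r → φ r ⊎ ψ r)
  (φ ⇒ ψ) p = ∀ q → q ≤ p → φ q → ψ q
  φ ⇔ ψ     = (φ ⇒ ψ) ∧ (ψ ⇒ φ)

  ∼_ : ∀ {ℓ} → Sentence ℓ → Sentence _
  (∼ φ) p = ∀ q → q ≤ p → ¬ φ q

  ⋀ ⋁ : ∀ {i ℓ} {I : Set i} → (I → Sentence ℓ) → Sentence _
  ⋀ φ p = ∀ x → φ x p
  ⋁ φ p = DenseBelow p (λ r → ∃[ x ] φ x r)

  -- Names for subsets of a ground-model set S: p ∈ τ x means that the pair
  -- (x̌ , p) belongs to the name τ.  Every subset of S in V[G] has such a name,
  -- so quantifying over all of them is quantifying over 𝒫(S) of V[G].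
  Name : ∀ {s} → Set s → Set (s ⊔ suc c)
  Name S = S → Pred Cond c

  infix 10 _∈̇_ _≐_ _⊆̇_

  _∈̇_ : ∀ {s} {S : Set s} → S → Name S → Sentence c
  (x ∈̇ τ) p = DenseBelow p (λ r → ∃[ t ] (t ∈ τ x × r ≤ t))

  _≐_ _⊆̇_ : ∀ {s} {S : Set s} → Name S → Name S → Sentence _
  σ ≐ τ = ⋀[ x ] (x ∈̇ σ ⇔ x ∈̇ τ)
  σ ⊆̇ τ = ⋀[ x ] (x ∈̇ σ ⇒ x ∈̇ τ)

  _ˇ : ∀ {s} {S : Set s} → Pred S 0ℓ → Name S
  (A ˇ) x _ = Lift c (x ∈ A)

  Ġ : Name Cond
  Ġ p q = p ≡ q

  -- A family of sentences indexed by S, read as the name {(x̌ , p) : p ⊩ φ x},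
  -- denotes the subset {x ∈ S : φ x} of V[G].
  ⟪_⟫ : ∀ {s} {S : Set s} → (S → Sentence c) → Name S
  ⟪ φ ⟫ = φ

  _∩̇_ : ∀ {s} {S : Set s} → Name S → Name S → Name S
  σ ∩̇ τ = ⟪ (λ x → x ∈̇ σ ∧ x ∈̇ τ) ⟫

  ∁̇ : ∀ {s} {S : Set s} → Name S → Name S
  ∁̇ σ = ⟪ (λ x → ∼ (x ∈̇ σ)) ⟫

  -- Finite subsets of a ground-model set in V[G] already lie in V.
  Finite : ∀ {s} {S : Set s} → Name S → Sentence _
  Finite τ = ⋁[ xs ] ⋀[ x ] (x ∈̇ τ ⇒ ⌜ x ∈ᴸ xs ⌝)

  -- Functions are given by their graphs.
  IsFunction : {S T : Set} → Name (S × T) → Sentence _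
  IsFunction F =
      (⋀[ x ] ⋁[ y ] ((x , y) ∈̇ F))
    ∧ (⋀[ x ] ⋀[ y ] ⋀[ z ] ((x , y) ∈̇ F ∧ (x , z) ∈̇ F ⇒ ⌜ y ≡ z ⌝))

  -- A family of subsets of ℤ in V[G], given by the sentences "τ ∈ 𝓤".
  Family : (ℓ : Level) → Set _
  Family ℓ = Name ℤ → Sentence ℓ

  IsUltrafilter NonPrincipal PPoint ℤ-Ramsey : ∀ {ℓ} → Family ℓ → Sentence _

  IsUltrafilter 𝓤 =
      ∼ 𝓤 (∅ ˇ)
    ∧ (⋀[ A ] ⋀[ B ] (𝓤 A ∧ A ⊆̇ B ⇒ 𝓤 B))
    ∧ (⋀[ A ] ⋀[ B ] (𝓤 A ∧ 𝓤 B ⇒ 𝓤 (A ∩̇ B)))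
    ∧ (⋀[ A ] (𝓤 A ∨ 𝓤 (∁̇ A)))

  NonPrincipal 𝓤 = ∼ (⋁[ x ] ⋀[ A ] (𝓤 A ⇔ x ∈̇ A))

  ConstantOn FiniteToOneOn : Name (ℤ × ℕ) → Name ℤ → Sentence _
  ConstantOn    f A = ⋁[ n ] ⋀[ x ] (x ∈̇ A ⇒ (x , n) ∈̇ f)
  FiniteToOneOn f A = ⋀[ n ] Finite ⟪ (λ x → x ∈̇ A ∧ (x , n) ∈̇ f) ⟫

  PPoint 𝓤 =
      IsUltrafilter 𝓤
    ∧ NonPrincipal 𝓤
    ∧ (⋀[ f ] (IsFunction f ⇒
         ⋁[ A ] (𝓤 A ∧ (ConstantOn f A ∨ FiniteToOneOn f A))))

  Invariant : Name ([ℤ]² × Fin 2) → Sentence _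
  Invariant χ = ⋀[ e ] ⋀[ z ] ⋀[ i ] ((e , i) ∈̇ χ ⇔ (translate z e , i) ∈̇ χ)

  Homogeneous : Name ([ℤ]² × Fin 2) → Name ℤ → Sentence _
  Homogeneous χ A =
    ⋁[ i ] ⋀[ e ] ([ℤ]².lo e ∈̇ A ∧ [ℤ]².hi e ∈̇ A ⇒ (e , i) ∈̇ χ)

  ℤ-Ramsey 𝓤 =
    ⋀[ χ ] (IsFunction χ ∧ Invariant χ ⇒ ⋁[ A ] (𝓤 A ∧ Homogeneous χ A))

_+ₛ_ : ℤ → Pred ℤ 0ℓ → Pred ℤ 0ℓ
(g +ₛ A) x = ∃[ a ] (a ∈ A × x ≡ g + a)

∣_∣≤_ : Pred ℤ 0ℓ → ℕ → Set
∣ A ∣≤ k = ∀ (xs : List ℤ) → Unique xs → All (_∈ A) xs → length xs ≤ᴺ k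

Thin : ℕ → Pred (Pred ℤ 0ℓ) 0ℓ
Thin k A = ∀ g → g ≢ 0ℤ → ∣ (g +ₛ A) ∩ A ∣≤ k

ThinIdeal : ℕ → Pred (Pred ℤ 0ℓ) (suc 0ℓ)
ThinIdeal k X = ∃[ Ts ] (All (Thin k) Ts × X ⊆ (λ x → Any (x ∈_) Ts))

module ThinForcing (k : ℕ) where

  -- Nonzero elements of 𝒫(ℤ)/I are given by representatives.  Two conditions
  -- represent the same element when each is ≼ the other.
  record Condition : Set (suc 0ℓ) where
    constructor condition
    field
      set      : Pred ℤ 0ℓ
      positive : set ∉ ThinIdeal k

  open Condition public

  _≼_ : Rel Condition (suc 0ℓ)
  X ≼ Y = set X ∖ set Y ∈ ThinIdeal k

  open Forcing _≼_ public

  -- The ground-model sets A whose class belongs to the generic filter.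
  u̇ : Family _
  u̇ τ = ⋁[ X ] (X ∈̇ Ġ ∧ τ ≐ (set X ˇ))

{-# OPTIONS --safe #-}

-- By compactness a positive set contains, for every n, a finite set that is not a union of
-- n thin sets.  Hence a decreasing sequence of positive sets has a positive
-- pseudo-intersection assembled from finite blocks, so the forcing adds no new ω-sequence
-- of ground-model elements, and u is an ultrafilter and a P-point because each name may be
-- decided and then handled in the ground model.
--
-- For the failure of ℤ-Ramseyness, choose the blocks F₀, F₁, … inside a given positive set
-- and moduli N₀ < N₁ < … so that Nₙ ≤ |x| and 4|x| < Nₙ₊₁ for x ∈ Fₙ, and all elements of
-- Fₙ, Fₙ₊₁, … are congruent modulo Nₙ.  Colour a pair by whether its difference d satisfies
-- Nₗ ∣ d and 2|d| < Nₗ₊₁ for some l.  A set all of whose pairs do so meets at most two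
-- blocks, so it is finite; a set none of whose pairs do so takes at most one element from
-- each block, so it grows so fast that it is 1-thin.  Neither is positive.
module Submission where

open import Defs
open import Axiom.ExcludedMiddle using (ExcludedMiddle)
open import Data.Empty using (⊥; ⊥-elim)
open import Data.Fin using (Fin; zero; suc)
open import Data.Integer using (ℤ; +_; -[1+_]; _+_; _-_; _*_; -_; ∣_∣)
  renaming (_<_ to _<ℤ_)
open import Data.Integer.DivMod using (_%ℕ_; _/ℕ_; n%ℕd<d; a≡a%ℕn+[a/ℕn]*n)
open import Data.Integer.Divisibility.Signed using (divides; ∣⇒∣ᵤ; ∣ᵤ⇒∣; ∣m∣n⇒∣m-n)
  renaming (_∣_ to _∣ℤ_)
import Data.Integer.Properties as ℤ
open import Algebra.Properties.AbelianGroup ℤ.+-0-abelianGroup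
  using (identityˡ-unique; ∙-cancelˡ; ∙-cancelʳ)
open import Data.Integer.Tactic.RingSolver using (solve-∀)
open import Data.List
  using (List; []; _∷_; _++_; length; lookup; map; tabulate; filter; applyUpTo)
open import Data.List.Membership.Propositional using () renaming (_∈_ to _∈ᴸ_)
open import Data.List.Membership.Propositional.Properties
  using (∈-lookup; ∈-filter⁺; ∈-filter⁻; ∈-applyUpTo⁺; ∈-++⁺ˡ; ∈-++⁺ʳ)
open import Data.List.Relation.Unary.All as All using (All; []; _∷_)
import Data.List.Relation.Unary.All.Properties as All
open import Data.List.Relation.Unary.AllPairs using (_∷_)
open import Data.List.Relation.Unary.Any as Any using (Any; here; there)
import Data.List.Relation.Unary.Any.Properties as Any
open import Data.Nat using (ℕ; zero; suc; _≤_; _<_; z≤n; s≤s; _⊔_; _≤?_)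
import Data.Nat as ℕ
open import Data.Nat.Divisibility using (∣⇒≤) renaming (_∣_ to _∣ᴺ_)
import Data.Nat.Properties as ℕ
open import Data.Nat.Tactic.RingSolver using () renaming (solve-∀ to ℕ-solve-∀)
open import Data.Product using (∃; ∃-syntax; _×_; _,_; proj₁; proj₂)
open import Data.Sum as Sum using (_⊎_; inj₁; inj₂; [_,_])
open import Data.Unit using (⊤; tt)
open import Function using (_∘_; id; const)
open import Level using (0ℓ; Lift; lift; lower) renaming (suc to lsuc)
open import Relation.Binary.Definitions using (tri<; tri≈; tri>)
open import Relation.Binary.PropositionalEquality
  using (_≡_; _≢_; refl; sym; trans; cong; cong₂; subst; module ≡-Reasoning)
open import Relation.Nullary using (¬_; Dec; yes; no; contradiction)
open import Relation.Nullary.Decidable using (map′; decidable-stable)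
open import Relation.Unary using (Pred; _∈_; _∉_; _⊆_; _∩_; _∖_; ∅; ∁)

-- An enumeration of the integers.

code : ℤ → ℕ
code (+ n)    = n ℕ.+ n
code -[1+ n ] = suc (n ℕ.+ n)

-- Runs through 0, -1, 1, -2, 2, ..., each integer being computed from the preceding one.
decode : ℕ → ℤ
decode zero    = + 0
decode (suc n) with decode n
... | + m      = -[1+ m ]
... | -[1+ m ] = + suc m

decode-double : ∀ n → decode (n ℕ.+ n) ≡ + n
decode-double zero = refl
decode-double (suc n) rewrite ℕ.+-suc n n | decode-double n = refl

decode-code : ∀ x → decode (code x) ≡ x
decode-code (+ n) = decode-double n
decode-code -[1+ n ] rewrite decode-double n = refl

-- Thin sets and the ideal they generate.

module _ {k : ℕ} where

  Thin-⊆ : ∀ {A B} → A ⊆ B → Thin k B → Thin k A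
  Thin-⊆ A⊆B thin g g≢0 xs uniq xs∈ = thin g g≢0 xs uniq
    (All.map (λ { ((a , a∈A , eq) , x∈A) → (a , A⊆B a∈A , eq) , A⊆B x∈A }) xs∈)

  Thin-∅ : ∀ {A} → (∀ {x} → x ∉ A) → Thin k A
  Thin-∅ A≡∅ _ _ []      _ _               = z≤n
  Thin-∅ A≡∅ _ _ (_ ∷ _) _ ((_ , x∈A) ∷ _) = contradiction x∈A A≡∅

  Thin-singleton : ∀ a → Thin k (_≡ a)
  Thin-singleton a g g≢0 []      _ _ = z≤n
  Thin-singleton a g g≢0 (_ ∷ _) _ (((_ , refl , eq) , refl) ∷ _) =
    contradiction (identityˡ-unique g a (sym eq)) g≢0

  ideal-⊆ : ∀ {X Y} → X ⊆ Y → Y ∈ ThinIdeal k → X ∈ ThinIdeal k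
  ideal-⊆ X⊆Y (Ts , thin , Y⊆) = Ts , thin , Y⊆ ∘ X⊆Y

  ideal-∪ : ∀ {X Y Z} → X ∈ ThinIdeal k → Y ∈ ThinIdeal k →
            (∀ {x} → x ∈ Z → x ∈ X ⊎ x ∈ Y) → Z ∈ ThinIdeal k
  ideal-∪ (Ts , thinT , X⊆) (Us , thinU , Y⊆) Z⊆ =
    Ts ++ Us , All.++⁺ thinT thinU ,
    λ x∈Z → [ Any.++⁺ˡ ∘ X⊆ , Any.++⁺ʳ Ts ∘ Y⊆ ] (Z⊆ x∈Z)

  ideal-∅ : ∀ {X} → (∀ {x} → x ∉ X) → X ∈ ThinIdeal k
  ideal-∅ X≡∅ = [] , [] , λ x∈X → contradiction x∈X X≡∅

  ideal-finite : ∀ xs → (_∈ᴸ xs) ∈ ThinIdeal k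
  ideal-finite xs =
    map (λ a x → x ≡ a) xs , All.map⁺ (All.universal Thin-singleton xs) , Any.map⁺

  ideal-thin : ∀ {X} → Thin k X → X ∈ ThinIdeal k
  ideal-thin {X} thin = X ∷ [] , thin ∷ [] , here

  ideal-fibres : ∀ {X} (h : ℤ → ℕ) → (∀ j → (λ x → x ∈ X × h x ≡ j) ∈ ThinIdeal k) →
                 ∀ n → (λ x → x ∈ X × h x < n) ∈ ThinIdeal k
  ideal-fibres h fib zero    = ideal-∅ λ { (_ , ()) }
  ideal-fibres h fib (suc n) = ideal-∪ (ideal-fibres h fib n) (fib n)
    λ { (x∈X , hx<) → [ (λ lt → inj₁ (x∈X , lt)) , (λ eq → inj₂ (x∈X , eq)) ]
          (ℕ.m≤n⇒m<n∨m≡n (ℕ.≤-pred hx<)) }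

-- A finite cover by thin sets amounts to a partition, since subsets of thin sets are thin.
-- Colourings are the form to which a tree argument applies.
ThinColouring : ℕ → ∀ {n} → (ℤ → Fin n) → Pred ℤ 0ℓ → Set
ThinColouring k c X = ∀ j → Thin k (λ x → x ∈ X × c x ≡ j)

colouring⇒ideal : ∀ {k n X} (c : ℤ → Fin n) → ThinColouring k c X → X ∈ ThinIdeal k
colouring⇒ideal c thin = tabulate _ , All.tabulate⁺ thin ,
  λ {x} x∈X → Any.tabulate⁺ (c x) (x∈X , refl)

Fin-bounded : ∀ {n} (f : Fin n → ℕ) → ∃[ N ] ∀ j → f j ≤ N
Fin-bounded {zero}  f = 0 , λ ()
Fin-bounded {suc n} f with Fin-bounded (f ∘ suc)
... | N , f≤N = f zero ⊔ N , λ where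
  zero    → ℕ.m≤m⊔n _ _
  (suc j) → ℕ.≤-trans (f≤N j) (ℕ.m≤n⊔m _ _)

module Classical (em : ExcludedMiddle (lsuc (lsuc 0ℓ))) where

  -- Deciding a Σ-type yields a witness, so excluded middle also supplies choice.
  dec₁ : (P : Set₁) → Dec P
  dec₁ P = map′ lower lift (em {Lift (lsuc (lsuc 0ℓ)) P})

  dec₀ : (P : Set) → Dec P
  dec₀ P = map′ lower lift (em {Lift (lsuc (lsuc 0ℓ)) P})

  stable : {P : Set₁} → ¬ ¬ P → P
  stable {P} = decidable-stable (dec₁ P)

  -- Kőnig's lemma.

  module _ {n : ℕ} where

    -- Nodes of level `N` are represented by total functions, so that no finite sequences have to be
    -- extended or truncated.
    record Tree : Set₁ where
      field
        Good      : ℕ → (ℕ → Fin n) → Set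
        antitone  : ∀ {M N d} → M ≤ N → Good N d → Good M d
        inhabited : ∀ N → ∃ (Good N)

    open Tree

    Extendible : Tree → Fin n → Set
    Extendible T j = ∀ N → ∃[ d ] (d 0 ≡ j × Good T N d)

    -- Pigeonhole: if every first value failed at some level, a function good at the largest of
    -- these levels would have a failing first value.
    extendible : ∀ T → ∃ (Extendible T)
    extendible T = decidable-stable (dec₀ _) λ none →
      let stuck : ∀ j → ∃[ N ] ¬ (∃[ d ] (d 0 ≡ j × Good T N d))
          stuck j = decidable-stable (dec₀ _) λ ¬stuck →
            none (j , λ N → decidable-stable (dec₀ _) λ ¬ext → ¬stuck (N , ¬ext))
          (M , ≤M) = Fin-bounded (proj₁ ∘ stuck)
          (d , dM) = inhabited T M
      in proj₂ (stuck (d 0)) (d , refl , antitone T (≤M (d 0)) dM)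

    -- The part of the tree above the chosen first value, with that value stripped off. Levels keep
    -- the numbering of the original tree.
    subtree : Tree → Tree
    subtree T = record
      { Good      = λ N d → ∃[ d′ ] (d′ 0 ≡ j × (∀ i → d′ (suc i) ≡ d i) × Good T N d′)
      ; antitone  = λ M≤N (d′ , d′0 , tail , l) → d′ , d′0 , tail , antitone T M≤N l
      ; inhabited = λ N → let (d′ , d′0 , l) = ext N in
                          d′ ∘ suc , d′ , d′0 , (λ _ → refl) , l
      }
      where j   = proj₁ (extendible T)
            ext = proj₂ (extendible T)

    branch : Tree → ℕ → Fin n
    branch T zero    = proj₁ (extendible T)
    branch T (suc i) = branch (subtree T) i

    -- The length `m` of the agreement and the level `N` vary independently: each initial segment of
    -- the branch extends to functions good at any prescribed level.
    kőnig : ∀ T m N → ∃[ d ] ((∀ i → i < m → d i ≡ branch T i) × Good T N d)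
    kőnig T zero    N = let (d , l) = inhabited T N in d , (λ _ ()) , l
    kőnig T (suc m) N with kőnig (subtree T) m N
    ... | d , agree , d′ , d′0 , tail , l = d′ , agree′ , l
      where
      agree′ : ∀ i → i < suc m → d′ i ≡ branch T i
      agree′ zero    _         = d′0
      agree′ (suc i) (s≤s i<m) = trans (tail i) (agree i i<m)

  -- Finite witnesses of positivity.

  ideal⇒colouring : ∀ {k X} → X ∈ ThinIdeal k →
                    ∃[ n ] ∃[ c ] ThinColouring k {suc n} c X
  ideal⇒colouring {k} {X} (Ts , thin , X⊆) = length Ts , (λ x → colour (dec₀ (x ∈ X))) , thin′
    where
    colour : ∀ {x} → Dec (x ∈ X) → Fin (suc (length Ts))
    colour (yes x∈X) = suc (Any.index (X⊆ x∈X))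
    -- A spare colour for the points outside `X`; its class inside `X` is empty.
    colour (no _)    = zero

    class-zero : ∀ {x} (d : Dec (x ∈ X)) → x ∈ X → colour d ≢ zero
    class-zero (no x∉X) x∈X = λ _ → x∉X x∈X

    class-suc : ∀ {x i} (d : Dec (x ∈ X)) → colour d ≡ suc i → x ∈ lookup Ts i
    class-suc (yes x∈X) refl = Any.lookup-index (X⊆ x∈X)

    thin′ : ThinColouring k (λ x → colour (dec₀ (x ∈ X))) X
    thin′ zero    = Thin-∅ λ (x∈X , eq) → class-zero (dec₀ _) x∈X eq
    thin′ (suc i) = Thin-⊆ (λ (_ , eq) → class-suc (dec₀ _) eq)
                           (All.lookup thin (∈-lookup i))

  -- With `suc n` colours the condition has content already at `n = 0`, since ℤ has no colouring
  -- with no colours.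
  Unthinnable : ℕ → ℕ → List ℤ → Set
  Unthinnable k n F = (c : ℤ → Fin (suc n)) → ¬ ThinColouring k c (_∈ᴸ F)

  -- De Bruijn–Erdős: thinness is witnessed by finite sets, so a colouring of X with thin
  -- classes is a branch of the tree of such colourings of its finite subsets.
  compactness : ∀ {k X} → X ∉ ThinIdeal k → ∀ n →
                ∃[ F ] (All (_∈ X) F × Unthinnable k n F)
  compactness {k} {X} X∉I n = decidable-stable (dec₀ _) λ none →
    X∉I (colouring⇒ideal (branch (tree none) ∘ code) (limit none))
    where
    module _ (none : ¬ (∃[ F ] (All (_∈ X) F × Unthinnable k n F))) where
      below : ℕ → List ℤ
      below N = filter (λ x → dec₀ (x ∈ X)) (applyUpTo decode N)

      below∈X : ∀ N → All (_∈ X) (below N)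
      below∈X N = All.tabulate λ x∈ → proj₂
        (∈-filter⁻ (λ x → dec₀ (x ∈ X)) {xs = applyUpTo decode N} x∈)

      ∈-below : ∀ {N x} → x ∈ X → code x < N → x ∈ᴸ below N
      ∈-below {N} {x} x∈X x<N = ∈-filter⁺ (λ x → dec₀ (x ∈ X))
        (subst (_∈ᴸ applyUpTo decode N) (decode-code x) (∈-applyUpTo⁺ decode x<N)) x∈X

      colouring-below : ∀ N → ∃[ c ] ThinColouring k {suc n} c (_∈ᴸ below N)
      colouring-below N = decidable-stable (dec₀ _) λ ¬c →
        none (below N , below∈X N , λ c good → ¬c (c , good))

      tree : Tree
      tree = record
        { Good      = λ N d → ThinColouring k (d ∘ code) (λ x → x ∈ X × code x < N)
        ; antitone  = λ M≤N thin j → Thin-⊆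
            (λ ((x∈X , x<M) , eq) → (x∈X , ℕ.<-≤-trans x<M M≤N) , eq) (thin j)
        ; inhabited = λ N → let (c , thin) = colouring-below N in c ∘ decode , λ j →
            Thin-⊆ (λ {x} ((x∈X , x<N) , eq) →
              ∈-below x∈X x<N , trans (cong c (sym (decode-code x))) eq) (thin j)
        }

      limit : ThinColouring k (branch tree ∘ code) X
      limit j g g≢0 xs uniq xs∈ =
        -- `N` exceeds the codes of the listed points and also of the points they are translates of,
        -- so that `d` and the branch agree on everything the overlap mentions.
        let (N , within) = bound xs∈
            (d , agree , thin) = kőnig tree N N
            restrict : ∀ {x} → x ∈ X × branch tree (code x) ≡ j → code x < N →
                       (x ∈ X × code x < N) × d (code x) ≡ j
            restrict = λ (x∈X , eq) x<N → (x∈X , x<N) , trans (agree _ x<N) eq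
        in thin j g g≢0 xs uniq (All.map
             (λ (((a , a∈ , eq) , x∈) , x<N , a<N) →
               (a , restrict a∈ a<N , eq) , restrict x∈ x<N) within)
        where
        C : Pred ℤ 0ℓ
        C x = x ∈ X × branch tree (code x) ≡ j

        bound : ∀ {xs} → All (_∈ (g +ₛ C) ∩ C) xs →
          ∃[ N ] All (λ x → ∃ {A = x ∈ (g +ₛ C) ∩ C} λ p →
                        code x < N × code (proj₁ (proj₁ p)) < N) xs
        bound [] = 0 , []
        bound {x ∷ _} (p@((a , _) , _) ∷ ps) with bound ps
        ... | N , within = M ⊔ N ,
            (p , ℕ.<-≤-trans (s≤s (ℕ.m≤m⊔n (code x) (code a))) (ℕ.m≤m⊔n M N)
               , ℕ.<-≤-trans (s≤s (ℕ.m≤n⊔m (code x) (code a))) (ℕ.m≤m⊔n M N)) ∷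
            All.map (λ (q , x<N , a<N) → q , ℕ.<-≤-trans x<N (ℕ.m≤n⊔m M N)
                                           , ℕ.<-≤-trans a<N (ℕ.m≤n⊔m M N)) within
          where M = suc (code x ⊔ code a)

  -- Fibres and pseudo-intersections of positive sets.

  module _ {k : ℕ} where

    ideal-∖ : ∀ {X Y} → X ∖ Y ∈ ThinIdeal k → X ∩ Y ∈ ThinIdeal k → X ∈ ThinIdeal k
    ideal-∖ {X} {Y} X∖Y X∩Y = ideal-∪ X∖Y X∩Y split
      where
      split : ∀ {x} → x ∈ X → x ∈ X ∖ Y ⊎ x ∈ X ∩ Y
      split {x} x∈X with dec₀ (x ∈ Y)
      ... | yes x∈Y = inj₂ (x∈X , x∈Y)
      ... | no  x∉Y = inj₁ (x∈X , x∉Y)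

    positive-fibre : ∀ {X} (h : ℤ → ℕ) n → (∀ x → h x < n) → X ∉ ThinIdeal k →
                     ∃[ j ] (λ x → x ∈ X × h x ≡ j) ∉ ThinIdeal k
    positive-fibre h n h<n X∉I = stable λ none → X∉I (ideal-⊆
      (λ {x} x∈X → x∈X , h<n x)
      (ideal-fibres h (λ j → stable λ fib → none (j , fib)) n))

  ⋃ : (ℕ → List ℤ) → Pred ℤ 0ℓ
  ⋃ F x = ∃[ n ] x ∈ᴸ F n

  -- A colouring of the union with `suc n` thin classes would restrict to the block `F n`, which
  -- admits none.
  ⋃-positive : ∀ {k F} → (∀ n → Unthinnable k n (F n)) → ⋃ F ∉ ThinIdeal k
  ⋃-positive unthinnable ⋃F∈I with ideal⇒colouring ⋃F∈I
  ... | n , c , thin = unthinnable n c λ j → Thin-⊆ (λ (x∈ , eq) → (n , x∈) , eq) (thin j)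

  ⋃< : (ℕ → List ℤ) → ℕ → List ℤ
  ⋃< F zero    = []
  ⋃< F (suc n) = F n ++ ⋃< F n

  ∈-⋃< : ∀ F {m n x} → m < n → x ∈ᴸ F m → x ∈ᴸ ⋃< F n
  ∈-⋃< F {m} {suc n} m<n x∈ with ℕ.m≤n⇒m<n∨m≡n (ℕ.≤-pred m<n)
  ... | inj₁ lt   = ∈-++⁺ʳ (F n) (∈-⋃< F lt x∈)
  ... | inj₂ refl = ∈-++⁺ˡ x∈

  pseudo-intersection : ∀ {k} (X : ℕ → Pred ℤ 0ℓ) → (∀ n → X n ∉ ThinIdeal k) →
    ∃[ F ] ((∀ n → All (_∈ X n) (F n)) × ⋃ F ∉ ThinIdeal k)
  pseudo-intersection X pos =
    proj₁ ∘ fin , proj₁ ∘ proj₂ ∘ fin , ⋃-positive (proj₂ ∘ proj₂ ∘ fin)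
    where fin = λ n → compactness (pos n) n

  decreasing : ∀ {X : ℕ → Pred ℤ 0ℓ} → (∀ n → X (suc n) ⊆ X n) →
               ∀ {m n} → m ≤ n → X n ⊆ X m
  decreasing dec {m} {n} m≤n with ℕ.m≤n⇒m<n∨m≡n m≤n
  decreasing dec {m} {suc n} m≤n | inj₁ m<n  = λ x∈ → decreasing dec (ℕ.≤-pred m<n) (dec n x∈)
  decreasing dec             m≤n | inj₂ refl = id

  -- Blocks from index `n` on lie inside `X n`, so only the finitely many points of the earlier
  -- blocks can fall outside it.
  almost-intersection : ∀ {k} (X : ℕ → Pred ℤ 0ℓ) → (∀ n → X (suc n) ⊆ X n) →
    (∀ n → X n ∉ ThinIdeal k) →
    ∃[ Y ] (Y ∉ ThinIdeal k × ∀ n → Y ∖ X n ∈ ThinIdeal k)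
  almost-intersection X dec pos =
    let (F , F⊆X , ⋃F∉I) = pseudo-intersection X pos in
    ⋃ F , ⋃F∉I , λ n → ideal-⊆
      (λ ((m , x∈) , x∉X) → ∈-⋃< F
        (ℕ.≰⇒> λ n≤m → x∉X (decreasing {X} dec n≤m (All.lookup (F⊆X m) x∈))) x∈)
      (ideal-finite (⋃< F n))

-- Lacunary sets are thin.

infix 4 _≪_

-- A record, because `x` and `y` cannot be inferred from their absolute values. The factor 4 lets
-- one term outweigh three smaller ones.
record _≪_ (x y : ℤ) : Set where
  constructor ≪-intro
  field ≪-elim : 4 ℕ.* ∣ x ∣ < ∣ y ∣

open _≪_

≪-trans : ∀ {x y z} → x ≪ y → y ≪ z → x ≪ z
≪-trans {y = y} (≪-intro x≪y) (≪-intro y≪z) =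
  ≪-intro (ℕ.<-trans x≪y (ℕ.≤-<-trans (ℕ.m≤n*m (∣ y ∣) 4) y≪z))

≪-irrefl : ∀ {x} → ¬ x ≪ x
≪-irrefl {x} (≪-intro x≪x) = ℕ.<⇒≱ x≪x (ℕ.m≤n*m (∣ x ∣) 4)

-- Equality would give `2|p| ≤ |r| + |s|`, but the right side is below `|p|/2`.
double-dominates : ∀ {p r s} → r ≪ p → s ≪ p → p + p ≢ r + s
double-dominates {p} {r} {s} r≪p s≪p eq = ℕ.<⇒≱ (begin-strict
  4 ℕ.* (∣ r ∣ ℕ.+ ∣ s ∣)       ≡⟨ ℕ.*-distribˡ-+ 4 (∣ r ∣) (∣ s ∣) ⟩
  4 ℕ.* ∣ r ∣ ℕ.+ 4 ℕ.* ∣ s ∣   <⟨ ℕ.+-mono-< (≪-elim r≪p) (≪-elim s≪p) ⟩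
  ∣ p ∣ ℕ.+ ∣ p ∣               ≤⟨ ℕ.m≤n*m _ 4 ⟩
  4 ℕ.* (∣ p ∣ ℕ.+ ∣ p ∣)       ∎) (ℕ.*-monoʳ-≤ 4 (begin
  ∣ p ∣ ℕ.+ ∣ p ∣               ≡⟨ doubled ∣ p ∣ ⟩
  2 ℕ.* ∣ p ∣                   ≡⟨ ℤ.abs-* (+ 2) p ⟨
  ∣ + 2 * p ∣                   ≡⟨ cong ∣_∣ (doubledℤ p) ⟨
  ∣ p + p ∣                     ≡⟨ cong ∣_∣ eq ⟩
  ∣ r + s ∣                     ≤⟨ ℤ.∣i+j∣≤∣i∣+∣j∣ r s ⟩
  ∣ r ∣ ℕ.+ ∣ s ∣               ∎))
  where
  open ℕ.≤-Reasoning
  doubled : ∀ n → n ℕ.+ n ≡ 2 ℕ.* n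
  doubled = ℕ-solve-∀
  doubledℤ : ∀ n → n + n ≡ + 2 * n
  doubledℤ = solve-∀

-- Isolating `p` would give `|p| ≤ |r| + |s| + |q| < 3|p|/4`.
sum-dominates : ∀ {p q r s} → q ≪ p → r ≪ p → s ≪ p → p + q ≢ r + s
sum-dominates {p} {q} {r} {s} q≪p r≪p s≪p eq = ℕ.<⇒≱ (begin-strict
  4 ℕ.* (∣ r ∣ ℕ.+ ∣ s ∣ ℕ.+ ∣ q ∣)
    ≡⟨ distrib (∣ r ∣) (∣ s ∣) (∣ q ∣) ⟩
  4 ℕ.* ∣ r ∣ ℕ.+ 4 ℕ.* ∣ s ∣ ℕ.+ 4 ℕ.* ∣ q ∣
    <⟨ ℕ.+-mono-< (ℕ.+-mono-< (≪-elim r≪p) (≪-elim s≪p)) (≪-elim q≪p) ⟩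
  ∣ p ∣ ℕ.+ ∣ p ∣ ℕ.+ ∣ p ∣
    ≤⟨ ℕ.m≤m+n _ ∣ p ∣ ⟩
  ∣ p ∣ ℕ.+ ∣ p ∣ ℕ.+ ∣ p ∣ ℕ.+ ∣ p ∣
    ≡⟨ four ∣ p ∣ ⟩
  4 ℕ.* ∣ p ∣ ∎) (ℕ.*-monoʳ-≤ 4 (begin
  ∣ p ∣                            ≡⟨ cong ∣_∣ (isolate p q) ⟩
  ∣ p + q - q ∣                    ≡⟨ cong (λ t → ∣ t - q ∣) eq ⟩
  ∣ r + s - q ∣                    ≤⟨ ℤ.∣i-j∣≤∣i∣+∣j∣ (r + s) q ⟩
  ∣ r + s ∣ ℕ.+ ∣ q ∣              ≤⟨ ℕ.+-monoˡ-≤ ∣ q ∣ (ℤ.∣i+j∣≤∣i∣+∣j∣ r s) ⟩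
  ∣ r ∣ ℕ.+ ∣ s ∣ ℕ.+ ∣ q ∣        ∎))
  where
  open ℕ.≤-Reasoning
  distrib : ∀ a b c → 4 ℕ.* (a ℕ.+ b ℕ.+ c) ≡ 4 ℕ.* a ℕ.+ 4 ℕ.* b ℕ.+ 4 ℕ.* c
  distrib = ℕ-solve-∀
  four : ∀ a → a ℕ.+ a ℕ.+ a ℕ.+ a ≡ 4 ℕ.* a
  four = ℕ-solve-∀
  isolate : ∀ a b → a ≡ a + b - b
  isolate = solve-∀

Lacunary : Pred ℤ 0ℓ → Set
Lacunary A = ∀ {x y} → x ∈ A → y ∈ A → x ≢ y → x ≪ y ⊎ y ≪ x

module _ {A : Pred ℤ 0ℓ} (lac : Lacunary A) where

  -- If `p` and `q` differ, the larger of them dominates the other three terms; if they agree, the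
  -- doubled term does.
  no-dominant : ∀ {p q r s} → p ∈ A → q ∈ A → r ≪ p → s ≪ p → p + q ≢ r + s
  no-dominant {p} {q} p∈ q∈ r≪p s≪p eq with p ℤ.≟ q
  ... | yes refl = double-dominates r≪p s≪p eq
  ... | no p≢q with lac p∈ q∈ p≢q
  ...   | inj₁ p≪q = sum-dominates p≪q (≪-trans r≪p p≪q) (≪-trans s≪p p≪q)
                       (trans (ℤ.+-comm q p) eq)
  ...   | inj₂ q≪p = sum-dominates q≪p r≪p s≪p eq

  -- If the pairs were disjoint, no element could dominate both members of the other
  -- pair, and the comparisons between the two pairs would form a cycle.
  lacunary-sums : ∀ {p q r s} → p ∈ A → q ∈ A → r ∈ A → s ∈ A →
                  p + q ≡ r + s → p ≢ s → p ≡ r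
  lacunary-sums {p} {q} {r} {s} p∈ q∈ r∈ s∈ eq p≢s with p ℤ.≟ r
  ... | yes p≡r = p≡r
  ... | no p≢r = ⊥-elim (cycle (lac p∈ r∈ p≢r) (lac p∈ s∈ p≢s) (lac q∈ r∈ q≢r) (lac q∈ s∈ q≢s))
    where
    q≢s : q ≢ s
    q≢s refl = p≢r (∙-cancelʳ q p r eq)
    q≢r : q ≢ r
    q≢r refl = p≢s (∙-cancelˡ q p s (trans (ℤ.+-comm q p) eq))
    eq′ : q + p ≡ r + s
    eq′ = trans (ℤ.+-comm q p) eq
    cycle : p ≪ r ⊎ r ≪ p → p ≪ s ⊎ s ≪ p → q ≪ r ⊎ r ≪ q → q ≪ s ⊎ s ≪ q → ⊥
    cycle (inj₂ r≪p) (inj₂ s≪p) _ _ = no-dominant p∈ q∈ r≪p s≪p eq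
    cycle _ _ (inj₂ r≪q) (inj₂ s≪q) = no-dominant q∈ p∈ r≪q s≪q eq′
    cycle (inj₁ p≪r) _ (inj₁ q≪r) _ = no-dominant r∈ s∈ p≪r q≪r (sym eq)
    cycle _ (inj₁ p≪s) _ (inj₁ q≪s) = no-dominant s∈ r∈ p≪s q≪s (trans (ℤ.+-comm s r) (sym eq))
    cycle (inj₁ p≪r) (inj₂ s≪p) (inj₂ r≪q) (inj₁ q≪s) =
      ≪-irrefl (≪-trans p≪r (≪-trans r≪q (≪-trans q≪s s≪p)))
    cycle (inj₂ r≪p) (inj₁ p≪s) (inj₁ q≪r) (inj₂ s≪q) =
      ≪-irrefl (≪-trans p≪s (≪-trans s≪q (≪-trans q≪r r≪p)))

  -- Two overlap points `a = g + a′` and `b = g + b′` satisfy `a + b′ = b + a′`. As `a ≠ a′`,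
  -- uniqueness of sums forces `a = b`.
  lacunary-thin : ∀ {k} → 1 ≤ k → Thin k A
  lacunary-thin 1≤k g g≢0 []           _ _ = z≤n
  lacunary-thin 1≤k g g≢0 (_ ∷ [])     _ _ = 1≤k
  lacunary-thin 1≤k g g≢0 (a ∷ b ∷ _) ((a≢b ∷ _) ∷ _)
    (((a′ , a′∈ , refl) , a∈) ∷ ((b′ , b′∈ , refl) , b∈) ∷ _) =
    contradiction (lacunary-sums a∈ b′∈ b∈ a′∈ (swap g a′ b′)
                    (g≢0 ∘ identityˡ-unique g a′)) a≢b
    where
    swap : ∀ g x y → g + x + y ≡ g + y + x
    swap = solve-∀

-- Differences within and across blocks.

module Blocks
  {N : ℕ → ℕ} {F : ℕ → List ℤ}
  (N-positive : ∀ n → 1 ≤ N n)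
  (N-increasing : ∀ n → N n < N (suc n))
  (lower : ∀ n {x} → x ∈ᴸ F n → N n ≤ ∣ x ∣)
  (upper : ∀ n {x} → x ∈ᴸ F n → 4 ℕ.* ∣ x ∣ < N (suc n))
  (congruent : ∀ {l m n} → l ≤ m → l ≤ n → ∀ {x y} → x ∈ᴸ F m → y ∈ᴸ F n →
               + N l ∣ℤ x - y)
  where

  -- Depends on the distance alone, which makes the colouring invariant. Within block `n` the level
  -- `l = n` works; across two blocks the later index is the only possible level.
  Close : ℕ → Set
  Close d = ∃[ l ] (N l ∣ᴺ d × 2 ℕ.* d < N (suc l))

  N-mono : ∀ {m n} → m ≤ n → N m ≤ N n
  N-mono {m} {n} m≤n with ℕ.m≤n⇒m<n∨m≡n m≤n
  N-mono {m} {suc n} m≤n | inj₁ m<n  = ℕ.≤-trans (N-mono (ℕ.≤-pred m<n)) (ℕ.<⇒≤ (N-increasing n))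
  N-mono             m≤n | inj₂ refl = ℕ.≤-refl

  N-reflects-< : ∀ {m n} → N m < N n → m < n
  N-reflects-< Nm<Nn = ℕ.≰⇒> λ n≤m → ℕ.<⇒≱ Nm<Nn (N-mono n≤m)

  blocks-≪ : ∀ {m n x y} → m < n → x ∈ᴸ F m → y ∈ᴸ F n → x ≪ y
  blocks-≪ {m} {n} m<n x∈ y∈ =
    ≪-intro (ℕ.<-≤-trans (upper m x∈) (ℕ.≤-trans (N-mono m<n) (lower n y∈)))

  -- At level `n` divisibility is the congruence of the block, and `4|x|, 4|y| < N (suc n)` yield
  -- the bound after cancelling a factor 2.
  block-close : ∀ {n x y} → x ∈ᴸ F n → y ∈ᴸ F n → Close ∣ x - y ∣
  block-close {n} {x} {y} x∈ y∈ =
    n , ∣⇒∣ᵤ (congruent ℕ.≤-refl ℕ.≤-refl x∈ y∈) , ℕ.*-cancelˡ-< 2 _ _ (begin-strict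
    2 ℕ.* (2 ℕ.* ∣ x - y ∣)           ≤⟨ ℕ.*-monoʳ-≤ 2 (ℕ.*-monoʳ-≤ 2 (ℤ.∣i-j∣≤∣i∣+∣j∣ x y)) ⟩
    2 ℕ.* (2 ℕ.* (∣ x ∣ ℕ.+ ∣ y ∣))   ≡⟨ expand (∣ x ∣) (∣ y ∣) ⟩
    4 ℕ.* ∣ x ∣ ℕ.+ 4 ℕ.* ∣ y ∣       <⟨ ℕ.+-mono-< (upper n x∈) (upper n y∈) ⟩
    N (suc n) ℕ.+ N (suc n)           ≡⟨ double (N (suc n)) ⟩
    2 ℕ.* N (suc n)                   ∎)
    where
    open ℕ.≤-Reasoning
    expand : ∀ a b → 2 ℕ.* (2 ℕ.* (a ℕ.+ b)) ≡ 4 ℕ.* a ℕ.+ 4 ℕ.* b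
    expand = ℕ-solve-∀
    double : ∀ a → a ℕ.+ a ≡ 2 ℕ.* a
    double = ℕ-solve-∀

  -- Here `2|y| ≥ 2 N n`, while `2|x| ≤ N n` because `x` comes from an earlier block.
  across-large : ∀ {m n x y} → m < n → x ∈ᴸ F m → y ∈ᴸ F n → N n ≤ 2 ℕ.* ∣ y - x ∣
  across-large {m} {n} {x} {y} m<n x∈ y∈ = ℕ.+-cancelʳ-≤ (N n) _ _ (begin
    N n ℕ.+ N n                           ≤⟨ ℕ.+-mono-≤ (lower n y∈) (lower n y∈) ⟩
    ∣ y ∣ ℕ.+ ∣ y ∣                       ≤⟨ ℕ.+-mono-≤ y≤ y≤ ⟩
    ∣ y - x ∣ ℕ.+ ∣ x ∣ ℕ.+ (∣ y - x ∣ ℕ.+ ∣ x ∣)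
                                          ≡⟨ regroup (∣ y - x ∣) (∣ x ∣) ⟩
    2 ℕ.* ∣ y - x ∣ ℕ.+ 2 ℕ.* ∣ x ∣       ≤⟨ ℕ.+-monoʳ-≤ (2 ℕ.* ∣ y - x ∣) 2x≤N ⟩
    2 ℕ.* ∣ y - x ∣ ℕ.+ N n               ∎)
    where
    open ℕ.≤-Reasoning
    restore : ∀ a b → a ≡ a - b + b
    restore = solve-∀
    regroup : ∀ a b → a ℕ.+ b ℕ.+ (a ℕ.+ b) ≡ 2 ℕ.* a ℕ.+ 2 ℕ.* b
    regroup = ℕ-solve-∀
    y≤ : ∣ y ∣ ≤ ∣ y - x ∣ ℕ.+ ∣ x ∣
    y≤ = subst (λ t → ∣ t ∣ ≤ ∣ y - x ∣ ℕ.+ ∣ x ∣) (sym (restore y x)) (ℤ.∣i+j∣≤∣i∣+∣j∣ (y - x) x)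
    2x≤N : 2 ℕ.* ∣ x ∣ ≤ N n
    2x≤N = begin
      2 ℕ.* ∣ x ∣   ≤⟨ ℕ.*-monoˡ-≤ (∣ x ∣) {2} {4} (s≤s (s≤s z≤n)) ⟩
      4 ℕ.* ∣ x ∣   ≤⟨ ℕ.<⇒≤ (upper m x∈) ⟩
      N (suc m)     ≤⟨ N-mono m<n ⟩
      N n           ∎

  across-small : ∀ {m n x y} → m < n → x ∈ᴸ F m → y ∈ᴸ F n → ∣ y - x ∣ < N (suc n)
  across-small {m} {n} {x} {y} m<n x∈ y∈ = begin-strict
    ∣ y - x ∣                 ≤⟨ ℤ.∣i-j∣≤∣i∣+∣j∣ y x ⟩
    ∣ y ∣ ℕ.+ ∣ x ∣           ≤⟨ ℕ.+-monoʳ-≤ (∣ y ∣) x≤y ⟩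
    ∣ y ∣ ℕ.+ ∣ y ∣           ≤⟨ ℕ.m≤m+n _ _ ⟩
    ∣ y ∣ ℕ.+ ∣ y ∣ ℕ.+ (∣ y ∣ ℕ.+ ∣ y ∣)   ≡⟨ four (∣ y ∣) ⟩
    4 ℕ.* ∣ y ∣               <⟨ upper n y∈ ⟩
    N (suc n)                 ∎
    where
    open ℕ.≤-Reasoning
    four : ∀ a → a ℕ.+ a ℕ.+ (a ℕ.+ a) ≡ 4 ℕ.* a
    four = ℕ-solve-∀
    x≤y : ∣ x ∣ ≤ ∣ y ∣
    x≤y = ℕ.≤-trans (ℕ.m≤n*m (∣ x ∣) 4) (ℕ.<⇒≤ (≪-elim (blocks-≪ m<n x∈ y∈)))

  -- The level `l` equals `n`: the distance `d` satisfies `N n ≤ 2d < N (suc l)`, and `N l`,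
  -- dividing the nonzero `d`, is at most `d < N (suc n)`.
  across-close : ∀ {m n x y} → m < n → x ∈ᴸ F m → y ∈ᴸ F n → Close ∣ y - x ∣ →
                 + N n ∣ℤ y - x
  across-close {m} {n} {x} {y} m<n x∈ y∈ (l , N∣d , small) =
    ∣ᵤ⇒∣ (subst (λ i → N i ∣ᴺ ∣ y - x ∣) (ℕ.≤-antisym l≤n n≤l) N∣d)
    where
    large : N n ≤ 2 ℕ.* ∣ y - x ∣
    large = across-large m<n x∈ y∈
    n≤l : n ≤ l
    n≤l = ℕ.≤-pred (N-reflects-< (ℕ.≤-<-trans large small))
    instance
      d≢0 : ℕ.NonZero ∣ y - x ∣
      d≢0 = ℕ.≢-nonZero λ d≡0 → ℕ.<⇒≱ (N-positive n)
        (subst (λ d → N n ≤ 2 ℕ.* d) d≡0 large)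
    l≤n : l ≤ n
    l≤n = ℕ.≤-pred (N-reflects-< (ℕ.≤-<-trans (∣⇒≤ N∣d) (across-small m<n x∈ y∈)))

  -- `N n` would divide `z - x` and `z - y`, hence the nonzero `y - x`, whose size is below
  -- `N (suc m) ≤ N n`.
  no-three-close : ∀ {l m n x y z} → l < m → m < n → x ∈ᴸ F l → y ∈ᴸ F m → z ∈ᴸ F n →
                   Close ∣ z - x ∣ → ¬ Close ∣ z - y ∣
  no-three-close {l} {m} {n} {x} {y} {z} l<m m<n x∈ y∈ z∈ zx zy =
    ℕ.<⇒≱ (across-small l<m x∈ y∈) (ℕ.≤-trans (N-mono m<n) (∣⇒≤ (∣⇒∣ᵤ N∣y-x)))
    where
    telescope : ∀ x y z → z - x - (z - y) ≡ y - x
    telescope = solve-∀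
    N∣y-x : + N n ∣ℤ y - x
    N∣y-x = subst (+ N n ∣ℤ_) (telescope x y z) (∣m∣n⇒∣m-n
      (across-close (ℕ.<-trans l<m m<n) x∈ z∈ zx) (across-close m<n y∈ z∈ zy))
    instance
      d≢0 : ℕ.NonZero ∣ y - x ∣
      d≢0 = ℕ.≢-nonZero λ d≡0 → ℕ.<⇒≱ (N-positive m)
        (subst (λ d → N m ≤ 2 ℕ.* d) d≡0 (across-large l<m x∈ y∈))

  module _ {H : Pred ℤ 0ℓ} (H⊆ : H ⊆ (λ x → ∃[ n ] x ∈ᴸ F n)) where

    far⇒lacunary : (∀ {x y} → x ∈ H → y ∈ H → x ≢ y → ¬ Close ∣ x - y ∣) → Lacunary H
    far⇒lacunary far x∈H y∈H x≢y with H⊆ x∈H | H⊆ y∈H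
    ... | m , x∈ | n , y∈ with ℕ.<-cmp m n
    ...   | tri< m<n _ _    = inj₁ (blocks-≪ m<n x∈ y∈)
    ...   | tri≈ _ refl _   = contradiction (block-close x∈ y∈) (far x∈H y∈H x≢y)
    ...   | tri> _ _ n<m    = inj₂ (blocks-≪ n<m y∈ x∈)

-- Passes from the increasing pairs that are coloured to the unordered pairs of the block arguments.
ordered⇒distinct : ∀ {H : Pred ℤ 0ℓ} (P : ℕ → Set) →
  (∀ {x y} → x ∈ H → y ∈ H → x <ℤ y → P ∣ y - x ∣) →
  ∀ {x y} → x ∈ H → y ∈ H → x ≢ y → P ∣ x - y ∣
ordered⇒distinct P h {x} {y} x∈H y∈H x≢y with ℤ.<-cmp x y
... | tri< x<y _ _ = subst P (ℤ.∣i-j∣≡∣j-i∣ y x) (h x∈H y∈H x<y)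
... | tri≈ _ x≡y _ = contradiction x≡y x≢y
... | tri> _ _ y<x = h y∈H x∈H y<x

-- Choice of blocks and moduli inside a positive set.

module Spread (em : ExcludedMiddle (lsuc (lsuc 0ℓ))) {k : ℕ} where
  open Classical em

  record Refinement (X : Pred ℤ 0ℓ) (M : ℕ) : Set₁ where
    field
      Y         : Pred ℤ 0ℓ
      Y⊆X       : Y ⊆ X
      positive  : Y ∉ ThinIdeal k
      large     : ∀ {x} → x ∈ Y → suc M ≤ ∣ x ∣
      congruent : ∀ {x y} → x ∈ Y → y ∈ Y → + suc M ∣ℤ x - y

  same-residue : ∀ x y M → x %ℕ suc M ≡ y %ℕ suc M → + suc M ∣ℤ x - y
  same-residue x y M eq = divides (x /ℕ suc M - y /ℕ suc M) (begin
    x - y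
      ≡⟨ cong₂ _-_ (a≡a%ℕn+[a/ℕn]*n x (suc M)) (a≡a%ℕn+[a/ℕn]*n y (suc M)) ⟩
    (+ (x %ℕ suc M) + x /ℕ suc M * + suc M) - (+ (y %ℕ suc M) + y /ℕ suc M * + suc M)
      ≡⟨ cong (λ r → (+ r + x /ℕ suc M * + suc M) - (+ (y %ℕ suc M) + y /ℕ suc M * + suc M)) eq ⟩
    (+ (y %ℕ suc M) + x /ℕ suc M * + suc M) - (+ (y %ℕ suc M) + y /ℕ suc M * + suc M)
      ≡⟨ collect (+ (y %ℕ suc M)) (x /ℕ suc M) (y /ℕ suc M) (+ suc M) ⟩
    (x /ℕ suc M - y /ℕ suc M) * + suc M ∎)
    where
    open ≡-Reasoning
    collect : ∀ r a b m → (r + a * m) - (r + b * m) ≡ (a - b) * m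
    collect = solve-∀

  -- Some residue class modulo `suc M` meets `X` in a positive set, and discarding its finitely many
  -- points of absolute value at most `M` keeps it positive.
  refine : ∀ {X} → X ∉ ThinIdeal k → ∀ M → Refinement X M
  refine {X} X∉I M = record
    { Y         = λ x → (x ∈ X × x %ℕ suc M ≡ r) × suc M ≤ ∣ x ∣
    ; Y⊆X       = proj₁ ∘ proj₁
    ; positive  = λ Y∈I → class∉I (ideal-∪ Y∈I
        (ideal-fibres {X = λ x → x ∈ X × x %ℕ suc M ≡ r} ∣_∣ sphere (suc M)) split)
    ; large     = proj₂
    ; congruent = λ {x} {y} ((_ , xr) , _) ((_ , yr) , _) →
        same-residue x y M (trans xr (sym yr))
    }
    where
    fibre = positive-fibre (_%ℕ suc M) (suc M) (λ x → n%ℕd<d x (suc M)) X∉I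
    r = proj₁ fibre
    class∉I = proj₂ fibre

    sphere : ∀ {X} j → (λ x → x ∈ X × ∣ x ∣ ≡ j) ∈ ThinIdeal k
    sphere j = ideal-⊆ (λ { {x} (_ , refl) → ± (ℤ.+∣i∣≡i⊎+∣i∣≡-i x) })
                       (ideal-finite (+ j ∷ - + j ∷ []))
      where
      ± : ∀ {x a} → a ≡ x ⊎ a ≡ - x → x ∈ᴸ a ∷ - a ∷ []
      ± (inj₁ refl) = here refl
      ± {x} (inj₂ refl) = there (here (sym (ℤ.neg-involutive x)))

    split : ∀ {x} → x ∈ X × x %ℕ suc M ≡ r →
            ((x ∈ X × x %ℕ suc M ≡ r) × suc M ≤ ∣ x ∣) ⊎
            ((x ∈ X × x %ℕ suc M ≡ r) × ∣ x ∣ < suc M)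
    split {x} x∈ with suc M ≤? ∣ x ∣
    ... | yes M<x = inj₁ (x∈ , M<x)
    ... | no  M≮x = inj₂ (x∈ , ℕ.≰⇒> M≮x)

  record Stage : Set₁ where
    field
      M          : ℕ
      {X}        : Pred ℤ 0ℓ
      refinement : Refinement X M
    open Refinement refinement public

  block : ∀ s n → ∃[ F ] (All (_∈ Stage.Y s) F × Unthinnable k n F)
  block s n = compactness (Stage.positive s) n

  radius : ∀ (F : List ℤ) → ∃[ B ] (∀ {x} → x ∈ᴸ F → ∣ x ∣ ≤ B)
  radius F with Fin-bounded (∣_∣ ∘ lookup F)
  ... | B , bound = B , λ x∈ →
    subst (λ y → ∣ y ∣ ≤ B) (sym (Any.lookup-index x∈)) (bound (Any.index x∈))

  next : Stage → ℕ → Stage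
  next s n = record
    -- With `B` the radius of the block, the new modulus `M + 4B + 2` exceeds both the old modulus
    -- `M + 1` and `4|x|` for each `x` in the block.
    { M          = suc (M ℕ.+ 4 ℕ.* proj₁ (radius (proj₁ (block s n))))
    ; refinement = refine positive _
    }
    where open Stage s

  module _ {X} (X∉I : X ∉ ThinIdeal k) where

    stage : ℕ → Stage
    stage zero    = record { M = 0 ; refinement = refine X∉I 0 }
    stage (suc n) = next (stage n) n

    open Stage using (M; Y)

    F : ℕ → List ℤ
    F n = proj₁ (block (stage n) n)

    F⊆Y : ∀ n {x} → x ∈ᴸ F n → x ∈ Y (stage n)
    F⊆Y n = All.lookup (proj₁ (proj₂ (block (stage n) n)))

    shrinking : ∀ {m n} → m ≤ n → Y (stage n) ⊆ Y (stage m)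
    shrinking = decreasing {X = Y ∘ stage} λ n → Stage.Y⊆X (stage (suc n))

    open Blocks {λ n → suc (M (stage n))} {F}
      (λ _ → s≤s z≤n)
      (λ n → s≤s (s≤s (ℕ.m≤m+n _ _)))
      (λ n x∈ → Stage.large (stage n) (F⊆Y n x∈))
      (λ n x∈ → s≤s (ℕ.m≤n⇒m≤1+n (ℕ.≤-trans (ℕ.*-monoʳ-≤ 4 (proj₂ (radius (F n)) x∈))
                                             (ℕ.m≤n+m _ (M (stage n))))))
      (λ {l} l≤m l≤n x∈ y∈ → Stage.congruent (stage l)
        (shrinking l≤m (F⊆Y _ x∈)) (shrinking l≤n (F⊆Y _ y∈)))
      public

    blocks⊆ : ⋃ F ⊆ X
    blocks⊆ (n , x∈) = Stage.Y⊆X (stage 0) (shrinking {0} {n} z≤n (F⊆Y n x∈))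

    blocks-positive : ⋃ F ∉ ThinIdeal k
    blocks-positive = ⋃-positive λ n → proj₂ (proj₂ (block (stage n) n))

    module _ {H : Pred ℤ 0ℓ} (H⊆ : H ⊆ ⋃ F) where

      far-negligible : 1 ≤ k → (∀ {x y} → x ∈ H → y ∈ H → x ≢ y → ¬ Close ∣ x - y ∣) →
                       H ∈ ThinIdeal k
      far-negligible 1≤k far = ideal-thin (lacunary-thin (far⇒lacunary H⊆ far) 1≤k)

      -- A positive `H` would meet arbitrarily late blocks, since finitely many blocks have finite
      -- union; points from three blocks then contradict `no-three-close`.
      close-negligible : (∀ {x y} → x ∈ H → y ∈ H → x ≢ y → Close ∣ x - y ∣) →
                         H ∈ ThinIdeal k
      close-negligible close = stable λ H∉I →
        let beyond : ∀ n → ∃[ m ] ∃[ x ] (n ≤ m × x ∈ H × x ∈ᴸ F m)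
            beyond n = decidable-stable (dec₀ _) λ none → H∉I (ideal-⊆
              (λ x∈H → let (m , x∈) = H⊆ x∈H in
                ∈-⋃< F (ℕ.≰⇒> λ n≤m → none (m , _ , n≤m , x∈H , x∈)) x∈)
              (ideal-finite (⋃< F n)))
            (l , x , _   , x∈H , x∈) = beyond 0
            (m , y , l<m , y∈H , y∈) = beyond (suc l)
            (n , z , m<n , z∈H , z∈) = beyond (suc m)
        in no-three-close l<m m<n x∈ y∈ z∈
             (close z∈H x∈H (distinct (ℕ.<-trans l<m m<n) x∈ z∈))
             (close z∈H y∈H (distinct m<n y∈ z∈))
        where
        distinct : ∀ {m n x y} → m < n → x ∈ᴸ F m → y ∈ᴸ F n → y ≢ x
        distinct m<n x∈ y∈ refl = ≪-irrefl (blocks-≪ m<n x∈ y∈)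

-- The forcing order and monotonicity.

module Generic (em : ExcludedMiddle (lsuc (lsuc 0ℓ))) {k : ℕ} (1≤k : 1 ≤ k) where
  open Classical em
  open ThinForcing k

  ⊆⇒≼ : ∀ {p q} → set p ⊆ set q → p ≼ q
  ⊆⇒≼ p⊆q = ideal-∅ λ (x∈p , x∉q) → x∉q (p⊆q x∈p)

  ≼-refl : ∀ {p} → p ≼ p
  ≼-refl {p} = ⊆⇒≼ {p} {p} id

  almost-trans : ∀ {A B C} → A ∖ B ∈ ThinIdeal k → B ∖ C ∈ ThinIdeal k → A ∖ C ∈ ThinIdeal k
  almost-trans {A} {B} {C} A∖B B∖C = ideal-∪ A∖B B∖C split
    where
    split : ∀ {x} → x ∈ A ∖ C → x ∈ A ∖ B ⊎ x ∈ B ∖ C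
    split {x} (x∈A , x∉C) with dec₀ (x ∈ B)
    ... | yes x∈B = inj₂ (x∈B , x∉C)
    ... | no  x∉B = inj₁ (x∈A , x∉B)

  ≼-trans : ∀ {p q r} → p ≼ q → q ≼ r → p ≼ r
  ≼-trans = almost-trans

  -- Separativity: if the part of `p` outside `A` were positive, it would be a condition below `p`
  -- with no extension almost contained in `A`.
  almost-⊆ : ∀ {A} p → DenseBelow p (λ r → set r ∖ A ∈ ThinIdeal k) →
             set p ∖ A ∈ ThinIdeal k
  almost-⊆ {A} p dense = stable λ p∖A∉I →
    let q = condition (set p ∖ A) p∖A∉I
        (r , r≼q , r∖A) = dense q (⊆⇒≼ {q} {p} proj₁)
    in positive r (ideal-∖ {Y = set q} r≼q
         (ideal-⊆ (λ (x∈r , (_ , x∉A)) → x∈r , x∉A) r∖A))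

  dense-mono : ∀ {ℓ p q} {D : Pred Condition ℓ} → q ≼ p → DenseBelow p D → DenseBelow q D
  dense-mono {p = p} {q} q≼p dense r r≼q = dense r (≼-trans {r} {q} {p} r≼q q≼p)

  dense-intro : ∀ {ℓ p} {D : Pred Condition ℓ} → (∀ q → q ≼ p → D q) → DenseBelow p D
  dense-intro d q q≼p = q , ≼-refl {q} , d q q≼p

  ∼-mono : ∀ {ℓ} {φ : Sentence ℓ} {p q} → q ≼ p → (∼ φ) p → (∼ φ) q
  ∼-mono {p = p} {q} q≼p ∼φ r r≼q = ∼φ r (≼-trans {r} {q} {p} r≼q q≼p)

  dense-trans : ∀ {ℓ p} {D : Pred Condition ℓ} →
                DenseBelow p (λ q → DenseBelow q D) → DenseBelow p D
  dense-trans dense q q≼p =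
    let (r , r≼q , denser) = dense q q≼p
        (s , s≼r , d)      = denser r (≼-refl {r})
    in s , ≼-trans {s} {r} {q} s≼r r≼q , d

  ⇔-mono : ∀ {ℓ m} {φ : Sentence ℓ} {ψ : Sentence m} {p q} → q ≼ p → (φ ⇔ ψ) p → (φ ⇔ ψ) q
  ⇔-mono {p = p} {q} q≼p (to , from) =
    (λ r r≼q → to r (≼-trans {r} {q} {p} r≼q q≼p)) ,
    (λ r r≼q → from r (≼-trans {r} {q} {p} r≼q q≼p))

  ≐-mono : ∀ {σ τ : Name ℤ} {p q} → q ≼ p → (σ ≐ τ) p → (σ ≐ τ) q
  ≐-mono {σ} {τ} {p} {q} q≼p σ≐τ x =
    ⇔-mono {φ = x ∈̇ σ} {ψ = x ∈̇ τ} {p} {q} q≼p (σ≐τ x)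

  -- Names of ground-model sets and of the generic filter.

  module _ {s} {S : Set s} where

    ˇ-intro : ∀ (A : Pred S 0ℓ) {x p} → x ∈ A → (x ∈̇ (A ˇ)) p
    ˇ-intro _ x∈A q _ = q , ≼-refl {q} , q , lift x∈A , ≼-refl {q}

    ˇ-elim : ∀ (A : Pred S 0ℓ) {x p} → (x ∈̇ (A ˇ)) p → x ∈ A
    ˇ-elim _ {p = p} x∈ with x∈ p (≼-refl {p})
    ... | _ , _ , _ , lift x∈A , _ = x∈A

    ⟪⟫-intro : ∀ {φ : S → Sentence (lsuc 0ℓ)} {x p} → (∀ q → q ≼ p → φ x q) → (x ∈̇ ⟪ φ ⟫) p
    ⟪⟫-intro φx q q≼p = q , ≼-refl {q} , q , φx q q≼p , ≼-refl {q}

    -- For arbitrary `φ` the sentence is only known at the condition `t` taken from the name; it has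
    -- to be carried down from `t` to `q` by monotonicity.
    ⟪⟫-elim : ∀ {φ : S → Sentence (lsuc 0ℓ)} {x p} → (x ∈̇ ⟪ φ ⟫) p →
              ∃[ q ] (q ≼ p × ∃[ t ] (q ≼ t × φ x t))
    ⟪⟫-elim {p = p} x∈ with x∈ p (≼-refl {p})
    ... | q , q≼p , t , φt , q≼t = q , q≼p , t , q≼t , φt

    decided⇒ground : ∀ {τ : Name S} {p} → (∀ x → (x ∈̇ τ) p ⊎ (∼ x ∈̇ τ) p) →
                     ∃[ A ] (τ ≐ (A ˇ)) p
    decided⇒ground {τ} {p} decided = A , λ x →
      (λ q q≼p x∈τ → ˇ-intro A {p = q} (sound {x} {q} (decided x) q≼p x∈τ)) ,
      (λ q q≼p x∈A → dense-mono {p = p} {q} q≼p (complete {x} (decided x) (ˇ-elim A {p = q} x∈A)))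
      where
      -- Forcing statements live above `Set`; the tag of the decision gives a ground-model predicate
      -- in `Set`.
      In : ∀ {x} → (x ∈̇ τ) p ⊎ (∼ x ∈̇ τ) p → Set
      In = [ const ⊤ , const ⊥ ]

      A : Pred S 0ℓ
      A x = In (decided x)

      sound : ∀ {x q} (d : (x ∈̇ τ) p ⊎ (∼ x ∈̇ τ) p) → q ≼ p → (x ∈̇ τ) q → In d
      sound (inj₁ _) _ _ = tt
      sound {q = q} (inj₂ x∉) q≼p x∈ = x∉ q q≼p x∈

      complete : ∀ {x} (d : (x ∈̇ τ) p ⊎ (∼ x ∈̇ τ) p) → In d → (x ∈̇ τ) p
      complete (inj₁ x∈) _ = x∈

  Ġ-intro : ∀ {p X} → p ≼ X → (X ∈̇ Ġ) p
  Ġ-intro {p} {X} p≼X q q≼p = q , ≼-refl {q} , X , refl , ≼-trans {q} {p} {X} q≼p p≼X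

  Ġ-elim : ∀ {p X} → (X ∈̇ Ġ) p → p ≼ X
  Ġ-elim {p} {X} X∈G = almost-⊆ p λ q q≼p → below q (X∈G q q≼p)
    where
    below : ∀ q → ∃[ r ] (r ≼ q × ∃[ t ] (X ≡ t × r ≼ t)) → ∃[ r ] (r ≼ q × r ≼ X)
    below q (r , r≼q , _ , refl , r≼X) = r , r≼q , r≼X

  -- Distributivity: no new subsets of ℤ and no new functions from ℤ to ℕ.

  abstract
    -- Enter `D 0`, `D 1`, ... one after the other and take an almost-intersection of the resulting
    -- chain.
    distributive : ∀ {ℓ} (D : ℕ → Pred Condition ℓ) → (∀ n {p q} → q ≼ p → D n p → D n q) →
                   ∀ p → (∀ n → DenseBelow p (D n)) → ∃[ q ] (q ≼ p × ∀ n → D n q)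
    distributive D D-open p dense = q , q≼X 0 , λ n →
        D-open n {p = proj₁ (step n)} {q} (≼-trans {q} {X (suc n)} {proj₁ (step n)} (q≼X (suc n))
                         (⊆⇒≼ {X (suc n)} {proj₁ (step n)} proj₁))
                (proj₂ (proj₂ (step n)))
      where
      chain : ℕ → ∃[ q ] q ≼ p
      step′ : ∀ n (s : ∃[ q ] q ≼ p) → ∃[ r ] (r ≼ proj₁ s × D n r)
      step′ n (q , q≼p) = dense n q q≼p
      chain zero    = p , ≼-refl {p}
      chain (suc n) =
        let (q , q≼p)     = chain n
            (r , r≼q , _) = step′ n (chain n)
            -- `r` is only almost contained in `q`; intersecting makes the chain decrease under true
            -- inclusion.
            m = condition (set r ∩ set q) λ r∩q∈I → positive r (ideal-∖ r≼q r∩q∈I)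
        in m , ≼-trans {m} {q} {p} (⊆⇒≼ {m} {q} proj₂) q≼p

      step : ∀ n → ∃[ r ] (r ≼ proj₁ (chain n) × D n r)
      step n = step′ n (chain n)

      X : ℕ → Condition
      X = proj₁ ∘ chain

      limit : ∃[ Y ] (Y ∉ ThinIdeal k × ∀ n → Y ∖ set (X n) ∈ ThinIdeal k)
      limit = almost-intersection (set ∘ X) (λ n → proj₂) (positive ∘ X)

      q : Condition
      q = condition (proj₁ limit) (proj₁ (proj₂ limit))

      q≼X : ∀ n → q ≼ X n
      q≼X = proj₂ (proj₂ limit)

    -- Deciding the membership of a single integer is dense, and the integers are enumerated by
    -- `decode`.
    decide-name : ∀ (τ : Name ℤ) p → ∃[ q ] (q ≼ p × ∃[ A ] (τ ≐ (A ˇ)) q)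
    decide-name τ p =
      let (q , q≼p , decided) = distributive Decided mono p dense in
      q , q≼p , decided⇒ground {τ = τ} {q} λ x →
        subst (λ y → (y ∈̇ τ) q ⊎ (∼ y ∈̇ τ) q) (decode-code x) (decided (code x))
      where
      Decided : ℕ → Pred Condition (lsuc 0ℓ)
      Decided n q = (decode n ∈̇ τ) q ⊎ (∼ decode n ∈̇ τ) q

      mono : ∀ n {p q} → q ≼ p → Decided n p → Decided n q
      mono n {p} {q} q≼p (inj₁ x∈) = inj₁ (dense-mono {p = p} {q} q≼p x∈)
      mono n {p} {q} q≼p (inj₂ x∉) = inj₂ (∼-mono {φ = decode n ∈̇ τ} {p} {q} q≼p x∉)

      dense : ∀ n → DenseBelow p (Decided n)
      dense n q _ with dec₁ (∃[ r ] (r ≼ q × (decode n ∈̇ τ) r))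
      ... | yes (r , r≼q , x∈) = r , r≼q , inj₁ x∈
      ... | no  none = q , ≼-refl {q} , inj₂ λ r r≼q x∈ → none (r , r≼q , x∈)

    decide-function : ∀ (f : Name (ℤ × ℕ)) p → IsFunction f p →
                      ∃[ q ] (q ≼ p × ∃ λ (g : ℤ → ℕ) → ∀ x → ((x , g x) ∈̇ f) q)
    decide-function f p (total , _) =
      let (q , q≼p , val) = distributive Valued mono p (λ n → total (decode n)) in
      q , q≼p , (λ x → proj₁ (val (code x))) , λ x →
        subst (λ y → ((y , proj₁ (val (code x))) ∈̇ f) q) (decode-code x) (proj₂ (val (code x)))
      where
      Valued : ℕ → Pred Condition (lsuc 0ℓ)
      Valued n q = ∃[ y ] ((decode n , y) ∈̇ f) q

      mono : ∀ n {p q} → q ≼ p → Valued n p → Valued n q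
      mono n {p} {q} q≼p (y , y∈) = y , dense-mono {p = p} {q} q≼p y∈

  -- Membership in the generic ultrafilter for decided names.

  ground-⊆ : ∀ {σ τ : Name ℤ} {A B p} → (σ ≐ (A ˇ)) p → (τ ≐ (B ˇ)) p → (σ ⊆̇ τ) p → A ⊆ B
  ground-⊆ {A = A} {B} {p} σ≐A τ≐B σ⊆τ {x} x∈A = ˇ-elim B {p = p} (proj₁ (τ≐B x) p p≼p
    (σ⊆τ x p p≼p (proj₂ (σ≐A x) p p≼p (ˇ-intro A {p = p} x∈A))))
    where p≼p = ≼-refl {p}

  u̇-intro : ∀ {τ A p} → (τ ≐ (A ˇ)) p → set p ∖ A ∈ ThinIdeal k → u̇ τ p
  u̇-intro {τ} {A} {p} τ≐A p∖A = dense-intro {p = p} λ q q≼p →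
    X , Ġ-intro {q} {X} (≼-trans {q} {p} {X} q≼p p∖A) , ≐-mono {τ} {A ˇ} {p} {q} q≼p τ≐A
    where
    X = condition A λ A∈I → positive p (ideal-∖ {Y = A} p∖A (ideal-⊆ proj₂ A∈I))

  -- Densely often a set of the generic filter equals `τ`, hence lies inside `A`; separativity
  -- removes the density.
  u̇-elim : ∀ {τ A p} → (τ ≐ (A ˇ)) p → u̇ τ p → set p ∖ A ∈ ThinIdeal k
  u̇-elim {τ} {A} {p} τ≐A τ∈u = almost-⊆ p λ q q≼p →
    let (r , r≼q , X , X∈G , τ≐X) = τ∈u q q≼p
        X⊆A = ground-⊆ {τ} {τ} {set X} {A} {r} τ≐X
          (≐-mono {τ} {A ˇ} {p} {r} (≼-trans {r} {q} {p} r≼q q≼p) τ≐A) (λ x _ _ → id)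
    in r , r≼q , ideal-⊆ (λ (x∈r , x∉A) → x∈r , x∉A ∘ X⊆A) (Ġ-elim {r} {X} X∈G)

  ≐-refl : ∀ {τ : Name ℤ} {p} → (τ ≐ τ) p
  ≐-refl x = (λ _ _ → id) , (λ _ _ → id)

  u̇-ˇ : ∀ A {p} → set p ∖ A ∈ ThinIdeal k → u̇ (A ˇ) p
  u̇-ˇ A {p} = u̇-intro {A ˇ} {A} {p} (≐-refl {A ˇ} {p})

  u̇-ˇ-elim : ∀ A {p} → u̇ (A ˇ) p → set p ∖ A ∈ ThinIdeal k
  u̇-ˇ-elim A {p} = u̇-elim {A ˇ} {A} {p} (≐-refl {A ˇ} {p})

  ∩̇-ground : ∀ {σ τ : Name ℤ} {A B p} → (σ ≐ (A ˇ)) p → (τ ≐ (B ˇ)) p →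
             ((σ ∩̇ τ) ≐ ((A ∩ B) ˇ)) p
  ∩̇-ground {σ} {τ} {A} {B} {p} σ≐A τ≐B x =
    (λ q q≼p x∈ → ˇ-intro (A ∩ B) {p = q} (to q q≼p (⟪⟫-elim {φ = φ} {x} {q} x∈))) ,
    (λ q q≼p x∈ → let (x∈A , x∈B) = ˇ-elim (A ∩ B) {p = q} x∈ in
      ⟪⟫-intro {φ = φ} {x} {q} λ r r≼q →
        let r≼p = ≼-trans {r} {q} {p} r≼q q≼p in
        proj₂ (σ≐A x) r r≼p (ˇ-intro A {p = r} x∈A) ,
        proj₂ (τ≐B x) r r≼p (ˇ-intro B {p = r} x∈B))
    where
    φ : ℤ → Sentence (lsuc 0ℓ)
    φ x = x ∈̇ σ ∧ x ∈̇ τ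
    to : ∀ q → q ≼ p → ∃[ r ] (r ≼ q × ∃[ t ] (r ≼ t × φ x t)) → x ∈ A ∩ B
    to q q≼p (r , r≼q , t , r≼t , x∈σ , x∈τ) =
      ˇ-elim A {p = r} (proj₁ (σ≐A x) r r≼p (dense-mono {p = t} {r} r≼t x∈σ)) ,
      ˇ-elim B {p = r} (proj₁ (τ≐B x) r r≼p (dense-mono {p = t} {r} r≼t x∈τ))
      where r≼p = ≼-trans {r} {q} {p} r≼q q≼p

  ∁̇-ground : ∀ {τ : Name ℤ} {A p} → (τ ≐ (A ˇ)) p → (∁̇ τ ≐ (∁ A ˇ)) p
  ∁̇-ground {τ} {A} {p} τ≐A x =
    (λ q q≼p x∈ → ˇ-intro (∁ A) {p = q} (to q q≼p (⟪⟫-elim {φ = φ} {x} {q} x∈))) ,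
    (λ q q≼p x∈ → ⟪⟫-intro {φ = φ} {x} {q} λ r r≼q s s≼r x∈τ →
      ˇ-elim (∁ A) {p = q} x∈ (ˇ-elim A {p = s} (proj₁ (τ≐A x) s
        (≼-trans {s} {r} {p} s≼r (≼-trans {r} {q} {p} r≼q q≼p)) x∈τ)))
    where
    φ : ℤ → Sentence (lsuc 0ℓ)
    φ x = ∼ (x ∈̇ τ)
    to : ∀ q → q ≼ p → ∃[ r ] (r ≼ q × ∃[ t ] (r ≼ t × φ x t)) → x ∉ A
    to q q≼p (r , r≼q , t , r≼t , x∉τ) x∈A = x∉τ r r≼t
      (proj₂ (τ≐A x) r (≼-trans {r} {q} {p} r≼q q≼p) (ˇ-intro A {p = r} x∈A))

  -- The ultrafilter axioms and nonprincipality.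

  u̇-proper : ⊩ ∼ u̇ (∅ ˇ)
  u̇-proper p q _ ∅∈u = positive q (ideal-⊆ (λ x∈q → x∈q , λ ()) (u̇-ˇ-elim ∅ {q} ∅∈u))

  -- Membership in `u̇` is a density statement, so it may be checked after an extension that decides
  -- both names, where it becomes almost inclusion.
  u̇-upward : ⊩ ⋀[ A ] ⋀[ B ] (u̇ A ∧ A ⊆̇ B ⇒ u̇ B)
  u̇-upward p σ τ q q≼p (σ∈u , σ⊆τ) = dense-trans {p = q} λ r r≼q →
    let (s , s≼r , A , σ≐A) = decide-name σ r
        (t , t≼s , B , τ≐B) = decide-name τ s
        t≼q = ≼-trans {t} {r} {q} (≼-trans {t} {s} {r} t≼s s≼r) r≼q
        σ≐A′ = ≐-mono {σ} {A ˇ} {s} {t} t≼s σ≐A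
        A⊆B = ground-⊆ {σ} {τ} {A} {B} {t} σ≐A′ τ≐B
                λ x u u≼t → σ⊆τ x u (≼-trans {u} {t} {q} u≼t t≼q)
        t∖A = u̇-elim {σ} {A} {t} σ≐A′ (dense-mono {p = q} {t} t≼q σ∈u)
    in t , ≼-trans {t} {s} {r} t≼s s≼r ,
         u̇-intro {τ} {B} {t} τ≐B (ideal-⊆ (λ {x} (x∈t , x∉B) → x∈t , x∉B ∘ A⊆B {x}) t∖A)

  u̇-∩ : ⊩ ⋀[ A ] ⋀[ B ] (u̇ A ∧ u̇ B ⇒ u̇ (A ∩̇ B))
  u̇-∩ p σ τ q q≼p (σ∈u , τ∈u) = dense-trans {p = q} λ r r≼q →
    let (s , s≼r , A , σ≐A) = decide-name σ r
        (t , t≼s , B , τ≐B) = decide-name τ s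
        t≼q = ≼-trans {t} {r} {q} (≼-trans {t} {s} {r} t≼s s≼r) r≼q
        σ≐A′ = ≐-mono {σ} {A ˇ} {s} {t} t≼s σ≐A
        t∖A = u̇-elim {σ} {A} {t} σ≐A′ (dense-mono {p = q} {t} t≼q σ∈u)
        t∖B = u̇-elim {τ} {B} {t} τ≐B (dense-mono {p = q} {t} t≼q τ∈u)
    in t , ≼-trans {t} {s} {r} t≼s s≼r ,
         u̇-intro {σ ∩̇ τ} {A ∩ B} {t} (∩̇-ground {σ} {τ} {A} {B} {t} σ≐A′ τ≐B)
           (ideal-∖ {Y = A} (ideal-⊆ (λ ((x∈t , _) , x∉A) → x∈t , x∉A) t∖A)
             (ideal-⊆ (λ ((x∈t , x∉A∩B) , x∈A) → x∈t , λ x∈B → x∉A∩B (x∈A , x∈B)) t∖B))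

  -- Once the name is decided as `A`, either `r` is already almost disjoint from `A`, or its
  -- intersection with `A` is a stronger condition.
  u̇-ultra : ⊩ ⋀[ A ] (u̇ A ∨ u̇ (∁̇ A))
  u̇-ultra p τ q q≼p with decide-name τ q
  ... | r , r≼q , A , τ≐A with dec₁ ((set r ∩ A) ∈ ThinIdeal k)
  ...   | yes r∩A∈I = r , r≼q , inj₂ (u̇-intro {∁̇ τ} {∁ A} {r} (∁̇-ground {τ} {A} {r} τ≐A)
            (ideal-⊆ (λ (x∈r , ¬x∉A) → x∈r , decidable-stable (dec₀ _) ¬x∉A) r∩A∈I))
  ...   | no  r∩A∉I =
    let s = condition (set r ∩ A) r∩A∉I
        s≼r = ⊆⇒≼ {s} {r} proj₁
    in s , ≼-trans {s} {r} {q} s≼r r≼q ,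
       inj₁ (u̇-intro {τ} {A} {s} (≐-mono {τ} {A ˇ} {r} {s} s≼r τ≐A)
         (ideal-∅ λ ((_ , x∈A) , x∉A) → x∉A x∈A))

  u̇-nonprincipal : ⊩ NonPrincipal u̇
  u̇-nonprincipal p q _ principal with principal q (≼-refl {q})
  ... | r , _ , x , eq = positive r
    (ideal-∖ {Y = _≡ x} r∖x (ideal-⊆ (here ∘ proj₂) (ideal-finite (x ∷ []))))
    where
    r∖x : set r ∖ (_≡ x) ∈ ThinIdeal k
    r∖x = u̇-ˇ-elim (_≡ x) {r}
      (proj₂ (eq ((_≡ x) ˇ)) r (≼-refl {r}) (ˇ-intro (_≡ x) {p = r} refl))

  -- The P-point property.

  constant-or-finite-to-one : ∀ {X} (g : ℤ → ℕ) → X ∉ ThinIdeal k →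
    ∃[ Y ] (Y ⊆ X × Y ∉ ThinIdeal k ×
      ((∃[ n ] ∀ {x} → x ∈ Y → g x ≡ n) ⊎
       (∀ n → ∃[ xs ] ∀ {x} → x ∈ Y → g x ≡ n → x ∈ᴸ xs)))
  constant-or-finite-to-one {X} g X∉I with dec₁ (∃[ n ] (λ x → x ∈ X × g x ≡ n) ∉ ThinIdeal k)
  ... | yes (n , fibre∉I) = _ , proj₁ , fibre∉I , inj₁ (n , proj₂)
  ... | no  none =
    -- On `F m` the function is at least `m`, so the value `n` occurs only in the first `suc n`
    -- blocks.
    ⋃ F , (λ (n , x∈) → proj₁ (F⊆ n x∈)) , ⋃F∉I ,
    inj₂ λ n → ⋃< F (suc n) , λ { (m , x∈) refl → ∈-⋃< F (s≤s (proj₂ (F⊆ m x∈))) x∈ }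
    where
    -- What the tail omits from `X` is covered by `n` fibres, each of them in the ideal in this
    -- case.
    tail∉I : ∀ n → (λ x → x ∈ X × n ≤ g x) ∉ ThinIdeal k
    tail∉I n tail∈I = X∉I (ideal-∪ tail∈I
      (ideal-fibres {X = X} g (λ j → stable λ fibre∉I → none (j , fibre∉I)) n)
      λ {x} x∈X → Sum.map (x∈X ,_) (x∈X ,_) (ℕ.≤-<-connex n (g x)))
    pseudo = pseudo-intersection (λ n x → x ∈ X × n ≤ g x) tail∉I
    F = proj₁ pseudo
    F⊆ = λ n {x} (x∈ : x ∈ᴸ F n) → All.lookup (proj₁ (proj₂ pseudo) n) x∈
    ⋃F∉I = proj₂ (proj₂ pseudo)

  function-mono : ∀ {S T : Set} {f : Name (S × T)} {p q} → q ≼ p → IsFunction f p → IsFunction f q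
  function-mono {p = p} {q} q≼p (total , single) =
    (λ x → dense-mono {p = p} {q} q≼p (total x)) ,
    (λ x y z r r≼q → single x y z r (≼-trans {r} {q} {p} r≼q q≼p))

  u̇-selects : ⊩ ⋀[ f ] (IsFunction f ⇒ ⋁[ A ] (u̇ A ∧ (ConstantOn f A ∨ FiniteToOneOn f A)))
  u̇-selects p f q _ fun = dense-trans {p = q} λ r r≼q →
    let (s , s≼r , g , g∈f) = decide-function f r (function-mono {f = f} {q} {r} r≼q fun)
        (Y , Y⊆s , Y∉I , cases) = constant-or-finite-to-one g (positive s)
        -- The set `Y` becomes the stronger condition, which puts it into the ultrafilter.
        t = condition Y Y∉I
        t≼s = ⊆⇒≼ {t} {s} Y⊆s
        s≼q = ≼-trans {s} {r} {q} s≼r r≼q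
    in t , ≼-trans {t} {s} {r} t≼s s≼r , dense-intro {p = t} λ u u≼t →
       Y ˇ , u̇-ˇ Y {u} u≼t , dense-intro {p = u} λ v v≼u →
       conclude g Y cases v
         (proj₂ (function-mono {f = f} {q} {v}
           (≼-trans {v} {u} {q} v≼u (≼-trans {u} {t} {q} u≼t (≼-trans {t} {s} {q} t≼s s≼q))) fun))
         λ x → dense-mono {p = s} {v}
           (≼-trans {v} {u} {s} v≼u (≼-trans {u} {t} {s} u≼t t≼s)) (g∈f x)
    where
    conclude : ∀ g Y →
      (∃[ n ] ∀ {x} → x ∈ Y → g x ≡ n) ⊎ (∀ n → ∃[ xs ] ∀ {x} → x ∈ Y → g x ≡ n → x ∈ᴸ xs) →
      ∀ p → (⋀[ x ] ⋀[ y ] ⋀[ z ] ((x , y) ∈̇ f ∧ (x , z) ∈̇ f ⇒ ⌜ y ≡ z ⌝)) p →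
      (∀ x → ((x , g x) ∈̇ f) p) → ConstantOn f (Y ˇ) p ⊎ FiniteToOneOn f (Y ˇ) p
    conclude g Y (inj₁ (n , g≡n)) p _ g∈f =
      inj₁ (dense-intro {p = p} λ q q≼p → n , λ x r r≼q x∈Y →
      subst (λ m → ((x , m) ∈̇ f) r) (g≡n (ˇ-elim Y {p = r} x∈Y))
        (dense-mono {p = p} {r} (≼-trans {r} {q} {p} r≼q q≼p) (g∈f x)))
    conclude g Y (inj₂ finite) p single g∈f = inj₂ λ n → dense-intro {p = p} λ q q≼p →
      proj₁ (finite n) , λ x r r≼q x∈ →
        member n x r (≼-trans {r} {q} {p} r≼q q≼p) (⟪⟫-elim {φ = fibre n} {x} {r} x∈)
      where
      fibre : ℕ → ℤ → Sentence (lsuc 0ℓ)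
      fibre n x = x ∈̇ (Y ˇ) ∧ (x , n) ∈̇ f

      member : ∀ n x r → r ≼ p → ∃[ s ] (s ≼ r × ∃[ t ] (s ≼ t × fibre n x t)) →
               x ∈ᴸ proj₁ (finite n)
      member n x r r≼p (s , s≼r , t , s≼t , x∈Y , x↦n) =
        -- Single-valuedness of `f` turns the forced value `n` into `g x ≡ n`.
        proj₂ (finite n) (ˇ-elim Y {p = t} x∈Y)
          (single x (g x) n s s≼p
            (dense-mono {p = p} {s} s≼p (g∈f x) , dense-mono {p = t} {s} s≼t x↦n))
        where s≼p = ≼-trans {s} {r} {p} s≼r r≼p

  u̇-PPoint : ⊩ PPoint u̇
  u̇-PPoint p =
    (u̇-proper p , u̇-upward p , u̇-∩ p , u̇-ultra p) , u̇-nonprincipal p , u̇-selects p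

  -- Failure of the ℤ-Ramsey property.

  module _ {X : Pred ℤ 0ℓ} (X∉I : X ∉ ThinIdeal k) where
    open Spread em

    bit : {P : Set} → Dec P → Fin 2
    bit (yes _) = zero
    bit (no _)  = suc zero

    bit-zero : ∀ {P} (d : Dec P) → bit d ≡ zero → P
    bit-zero (yes p) _ = p

    bit-one : ∀ {P} (d : Dec P) → bit d ≡ suc zero → ¬ P
    bit-one (no ¬p) _ = ¬p

    colour : ℕ → Fin 2
    colour d = bit (dec₀ (Close X∉I d))

    homogeneous-negligible : ∀ {H} → H ⊆ ⋃ (F X∉I) → ∀ i →
      (∀ {x y} → x ∈ H → y ∈ H → x <ℤ y → colour ∣ y - x ∣ ≡ i) → H ∈ ThinIdeal k
    homogeneous-negligible {H} H⊆ i hom = by-colour i (ordered⇒distinct (λ d → colour d ≡ i) hom)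
      where
      by-colour : ∀ i → (∀ {x y} → x ∈ H → y ∈ H → x ≢ y → colour ∣ x - y ∣ ≡ i) →
                  H ∈ ThinIdeal k
      by-colour zero       h = close-negligible X∉I H⊆
        λ x∈ y∈ x≢y → bit-zero (dec₀ _) (h x∈ y∈ x≢y)
      by-colour (suc zero) h = far-negligible X∉I H⊆ 1≤k
        λ x∈ y∈ x≢y → bit-one (dec₀ _) (h x∈ y∈ x≢y)

    difference : [ℤ]² → ℕ
    difference e = ∣ [ℤ]².hi e - [ℤ]².lo e ∣

    difference-translate : ∀ z e → difference (translate z e) ≡ difference e
    difference-translate z (pair x y _) = cong ∣_∣ (shift x y z)
      where
      shift : ∀ x y z → z + y - (z + x) ≡ y - x
      shift = solve-∀

    ColourGraph : Pred ([ℤ]² × Fin 2) 0ℓ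
    ColourGraph (e , i) = colour (difference e) ≡ i

    ∈-graph : ∀ {e i} p → colour (difference e) ≡ i → ((e , i) ∈̇ (ColourGraph ˇ)) p
    ∈-graph {e} {i} p = ˇ-intro ColourGraph {e , i} {p}

    graph-∈ : ∀ {e i} p → ((e , i) ∈̇ (ColourGraph ˇ)) p → colour (difference e) ≡ i
    graph-∈ {e} {i} p = ˇ-elim ColourGraph {e , i} {p}

    colouring-function : ⊩ IsFunction (ColourGraph ˇ)
    colouring-function p =
      (λ e → dense-intro {p = p} λ q _ → colour (difference e) , ∈-graph {e} q refl) ,
      (λ e i j q _ (ei , ej) → trans (sym (graph-∈ {e} q ei)) (graph-∈ {e} q ej))

    colouring-invariant : ⊩ Invariant (ColourGraph ˇ)
    colouring-invariant p e z i =
      (λ q _ ei → ∈-graph {translate z e} q (trans same (graph-∈ {e} q ei))) ,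
      (λ q _ ei → ∈-graph {e} q (trans (sym same) (graph-∈ {translate z e} q ei)))
      where
      same : colour (difference (translate z e)) ≡ colour (difference e)
      same = cong colour (difference-translate z e)

    -- Decide `A` as `B`. Homogeneity puts the part of `B` inside the blocks into the ideal, yet the
    -- condition is almost contained in both `B` and the union of the blocks.
    no-homogeneous : ∀ {A : Name ℤ} p → set p ∖ ⋃ (F X∉I) ∈ ThinIdeal k → u̇ A p →
                     ¬ Homogeneous (ColourGraph ˇ) A p
    no-homogeneous {A} p p⊆Y A∈u hom =
      let (q , q≼p , i , homᵢ) = hom p (≼-refl {p})
          (r , r≼q , B , A≐B)  = decide-name A q
          r≼p = ≼-trans {r} {q} {p} r≼q q≼p
          r⊆B = u̇-elim {A} {B} {r} A≐B (dense-mono {p = p} {r} r≼p A∈u)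
          r⊆Y = almost-trans r≼p p⊆Y
          ∈A : ∀ {x} → x ∈ B → (x ∈̇ A) r
          ∈A {x} x∈B = proj₂ (A≐B x) r (≼-refl {r}) (ˇ-intro B {p = r} x∈B)
          B∩Y∈I : B ∩ ⋃ (F X∉I) ∈ ThinIdeal k
          B∩Y∈I = homogeneous-negligible proj₂ i λ {x} {y} (x∈B , _) (y∈B , _) x<y →
            graph-∈ {pair x y x<y} r (homᵢ (pair x y x<y) r r≼q (∈A x∈B , ∈A y∈B))
      in positive r (ideal-∖ {Y = B} r⊆B
           (ideal-∖ {Y = ⋃ (F X∉I)} (ideal-⊆ (λ ((x∈r , _) , x∉Y) → x∈r , x∉Y) r⊆Y)
             (ideal-⊆ (λ ((_ , x∈B) , x∈Y) → x∈B , x∈Y) B∩Y∈I)))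

  -- The colouring is built from blocks inside the given condition `q`; the union of the blocks
  -- extends `q`, and no condition below it admits a homogeneous set in the ultrafilter.
  u̇-not-ℤ-Ramsey : ⊩ ∼ ℤ-Ramsey u̇
  u̇-not-ℤ-Ramsey p q _ ramsey =
    let X∉I = positive q
        r = condition (⋃ (Spread.F em X∉I)) (Spread.blocks-positive em X∉I)
        (s , s≼r , A , A∈u , hom) = ramsey (ColourGraph X∉I ˇ) q (≼-refl {q})
          (colouring-function X∉I q , colouring-invariant X∉I q)
          r (⊆⇒≼ {r} {q} (Spread.blocks⊆ em X∉I))
    in no-homogeneous X∉I {A} s s≼r A∈u hom

corollary3p8 : ExcludedMiddle (lsuc (lsuc 0ℓ)) → (k : ℕ) → 1 ≤ k →
    let open ThinForcing k in ⊩ PPoint u̇ ∧ ∼ ℤ-Ramsey u̇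
corollary3p8 em k 1≤k p = u̇-PPoint p , u̇-not-ℤ-Ramsey p
  where open Generic em 1≤k
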